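{- There is a map $F$ from the set of finite words with nonnegative integer letters to itself such that (i) $F(w)$ is a rearrangement of $w$ for every $w$, and the restriction of $F$ to each rearrangement class is a bijection of that class onto itself; and (ii) $(\mathrm{dec}\,w,\mathrm{single}\,w)=(\mathrm{wlec}\,F(w),\mathrm{wpix}\,F(w))$ for every $w$.
   Context: For $w=x_1\cdots x_n$, $i\in\{1,\dots,n-1\}$ is a decrease if $x_i\ge\cdots\ge x_j>x_{j+1}$ for some $i\le j\le n-1$; $\mathrm{dec}\,w$ counts them. A nonempty word is Lyndon if it has length $1$ or is lexicographically strictly greater than its proper cyclic rotations; for primitive words $w\preceq w'$ iff $w^b\le w'^b$ lexicographically for large $b$; every nonempty word factors uniquely as $l_1\cdots l_k$ with Lyndon words $l_1\preceq\cdots\preceq l_k$, and $\mathrm{single}\,w$ is the number of one-letter factors. An $H$-word is a word $x_1\cdots x_k$, $k\ge2$, with $x_1<x_2$ and either $k=2$ or $x_2\ge\cdots\ge x_k$; each word factors uniquely as $u\,h_1\cdots h_k$ with $u$ nonincreasing (possibly empty) and each $h_i$ an $H$-word; $\mathrm{wpix}\,w$ is the length of $u$ and $\mathrm{wlec}\,w=\sum_i\mathrm{inv}(\text{reverse of }h_i)$, $\mathrm{inv}$ counting pairs of positions $a<b$ with $x_a>x_b$. -}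

module Defs where

open import Data.Nat using (ℕ; zero; suc; _+_; _<_; _≤_; _≥_; _>_; _<ᵇ_; _≡ᵇ_)
open import Data.Bool using (Bool; true; false; if_then_else_)
open import Data.List using (List; []; _∷_; _++_; concat; replicate; length; drop; take; map; reverse)
open import Data.Nat.ListAction using (sum)
open import Data.Empty using (⊥)
open import Data.List.Relation.Unary.All using (All)
open import Data.List.Relation.Unary.Linked using (Linked)
open import Data.Product using (_×_; ∃)
open import Data.Sum using (_⊎_)
open import Relation.Binary.PropositionalEquality using (_≡_)

Word : Set
Word = List ℕ

-- decFrom a r : with a = x_i and r = x_{i+1} ⋯ x_n, is there j ≥ i with
-- x_i ≥ ⋯ ≥ x_j > x_{j+1} ?
decFrom : ℕ → Word → Bool
decFrom a [] = false
decFrom a (b ∷ r) = if b <ᵇ a then true else (if a ≡ᵇ b then decFrom b r else false)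

dec : Word → ℕ
dec [] = 0
dec (a ∷ r) = (if decFrom a r then 1 else 0) + dec r

data LexLeq : Word → Word → Set where
  nil  : ∀ {v} → LexLeq [] v
  lt   : ∀ {a b u v} → a < b → LexLeq (a ∷ u) (b ∷ v)
  step : ∀ {a u v} → LexLeq u v → LexLeq (a ∷ u) (a ∷ v)

data LexLt : Word → Word → Set where
  nil  : ∀ {b v} → LexLt [] (b ∷ v)
  lt   : ∀ {a b u v} → a < b → LexLt (a ∷ u) (b ∷ v)
  step : ∀ {a u v} → LexLt u v → LexLt (a ∷ u) (a ∷ v)

_^w_ : Word → ℕ → Word
w ^w b = concat (replicate b w)

_≼_ : Word → Word → Set
w ≼ w' = ∃ λ B → ∀ b → B ≤ b → LexLeq (w ^w b) (w' ^w b)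

rotate : ℕ → Word → Word
rotate k w = drop k w ++ take k w

-- Lyndon (in the paper's convention: strictly greater than its proper rotations)
Lyndon : Word → Set
Lyndon w = (length w ≡ 1) ⊎
           ((w ≡ [] → ⊥) × (∀ k → 0 < k → k < length w → LexLt (rotate k w) w))

LyndonFactorization : Word → List Word → Set
LyndonFactorization w ls = (w ≡ concat ls) × All Lyndon ls × Linked _≼_ ls

singles : List Word → ℕ
singles [] = 0
singles (l ∷ ls) = (if length l ≡ᵇ 1 then 1 else 0) + singles ls

data HWord : Word → Set where
  hword : ∀ {x₁ x₂ rest} → x₁ < x₂ →
          (rest ≡ [] ⊎ Linked _≥_ (x₂ ∷ rest)) → HWord (x₁ ∷ x₂ ∷ rest)

HFactorization : Word → Word → List Word → Set
HFactorization w u hs = (w ≡ u ++ concat hs) × Linked _≥_ u × All HWord hs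

count> : ℕ → Word → ℕ
count> x [] = 0
count> x (y ∷ r) = (if y <ᵇ x then 1 else 0) + count> x r

inv : Word → ℕ
inv [] = 0
inv (x ∷ r) = count> x r + inv r

wlecOf : List Word → ℕ
wlecOf hs = sum (map (λ h → inv (reverse h)) hs)

{-# OPTIONS --safe #-}
module Submission where

open import Defs
open import Data.Nat using (ℕ; suc; _+_; _⊔_; _<ᵇ_; _≤ᵇ_; _<_; _≤_; _≥_; _>_; s≤s; z≤n)
open import Data.Nat.Properties
open import Data.Nat.Induction using (<-wellFounded; Acc; acc)
open import Data.Bool using (true; false; if_then_else_)
open import Data.Maybe using (Maybe; just; nothing)
import Data.Maybe.Relation.Unary.All as Maybe
open import Data.List using (List; []; _∷_; _++_; length; concat; reverse; take; drop; foldr; [_]; initLast; _∷ʳ′_)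
open import Data.List.Properties
open import Data.List.Relation.Unary.All as All using (All; []; _∷_)
open import Data.List.Relation.Unary.All.Properties using (++⁺; ++⁻ˡ; ++⁻ʳ)
open import Data.List.Membership.Propositional using (_∈_)
open import Data.List.Membership.Propositional.Properties using (∈-∃++)
open import Data.List.Relation.Unary.Linked using (Linked; []; [-]; _∷_)
open import Data.List.Relation.Binary.Permutation.Propositional using (_↭_; ↭-sym; ↭-reflexive; prep; module PermutationReasoning)
open import Data.List.Relation.Binary.Permutation.Propositional.Properties using (↭-reverse; All-resp-↭; ↭-length; ++⁺ˡ; ++⁺ʳ; shifts)
open import Data.Product using (_×_; ∃; ∃₂; _,_; proj₁; proj₂)
open import Data.Sum using (_⊎_; inj₁; inj₂)
open import Data.Empty using (⊥-elim)
open import Function using (flip)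
open import Relation.Nullary using (¬_; Dec; yes; no)
open import Relation.Nullary.Decidable using (_×-dec_; dec-true; dec-false)
open import Relation.Binary.PropositionalEquality using (_≡_; refl; sym; trans; cong; cong₂; subst; subst₂; module ≡-Reasoning)

-- Let w end in y₁ ≥ ⋯ ≥ y_r > z₁ ≤ z₂ ≤ ⋯ with r maximal. Take all z < y_r, say z₁ ≤ ⋯ ≤ z_j = x,
-- let q be the letter following x (∞ if there is none), and remove from w the V-shaped factor
-- y_i ⋯ y_r z₁ ⋯ z_j, where y_i, …, y_r are the letters y ≤ q. This cut lowers dec by the
-- number of letters > x of the factor, and the factor sorted as x, y_i, …, y_r, z_{j-1}, …, z₁ is an
-- arbitrary H-word h with that value of inv (reverse h). The inverse step is possible for every
-- H-word in exactly one way: insert into the last maximal weakly ascending run, before its first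
-- letter ≥ y_i. Iterating the cut leaves a weakly ascending word, the reversal of u. Finally, the
-- one-letter Lyndon factors are the weak left-to-right maxima that are not decreases, and their
-- number is unchanged by the cut.

-- Maximal prefixes of a word

StepRel : Set₁
StepRel = Maybe ℕ → ℕ → Set

-- A step may look at the preceding letter, `nothing` when there is none. One notion thus covers
-- monotone prefixes, prefixes bounded by a condition on single letters, and both at once.
data Chain (R : StepRel) : Maybe ℕ → Word → Set where
  []  : ∀ {q} → Chain R q []
  _∷_ : ∀ {q b p} → R q b → Chain R (just b) p → Chain R q (b ∷ p)

data Stop (R : StepRel) : Maybe ℕ → Word → Set where
  []      : ∀ {q} → Stop R q []
  blocked : ∀ {q b r} → ¬ R q b → Stop R q (b ∷ r)

lastOr : Maybe ℕ → Word → Maybe ℕ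
lastOr q []      = q
lastOr q (b ∷ p) = lastOr (just b) p

lastOr-++ : ∀ q p {r} → lastOr q (p ++ r) ≡ lastOr (lastOr q p) r
lastOr-++ q []      = refl
lastOr-++ q (b ∷ p) = lastOr-++ (just b) p

lastOr-reverse : ∀ q y p → lastOr q (reverse (y ∷ p)) ≡ just y
lastOr-reverse q y p = trans (cong (lastOr q) (unfold-reverse y p)) (lastOr-++ q (reverse p))

maximal-chain-exists : ∀ {R} → (∀ q b → Dec (R q b)) → ∀ q w →
  ∃₂ λ p r → w ≡ p ++ r × Chain R q p × Stop R (lastOr q p) r
maximal-chain-exists R? q [] = [] , [] , refl , [] , []
maximal-chain-exists R? q (b ∷ w) with R? q b
... | no ¬Rqb = [] , b ∷ w , refl , [] , blocked ¬Rqb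
... | yes Rqb with maximal-chain-exists R? (just b) w
...   | p , r , refl , c , s = b ∷ p , r , refl , Rqb ∷ c , s

-- Where one prefix ends and the other goes on, `Stop` contradicts the next step. All uniqueness of
-- cuts and insertions comes from here: each piece of a word is recognised as a maximal chain.
maximal-chain-unique : ∀ {R q p r p′ r′} →
  Chain R q p → Stop R (lastOr q p) r → Chain R q p′ → Stop R (lastOr q p′) r′ →
  p ++ r ≡ p′ ++ r′ → p ≡ p′ × r ≡ r′
maximal-chain-unique [] _ [] _ eq = refl , eq
maximal-chain-unique [] (blocked ¬Rqb) (Rqb ∷ _) _ refl = ⊥-elim (¬Rqb Rqb)
maximal-chain-unique (Rqb ∷ _) _ [] (blocked ¬Rqb) refl = ⊥-elim (¬Rqb Rqb)
maximal-chain-unique (_ ∷ c) s (_ ∷ c′) s′ eq with ∷-injective eq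
... | refl , eq′ with maximal-chain-unique c s c′ s′ eq′
...   | refl , refl = refl , refl

chain-++⁺ : ∀ {R q p r} → Chain R q p → Chain R (lastOr q p) r → Chain R q (p ++ r)
chain-++⁺ []      d = d
chain-++⁺ (x ∷ c) d = x ∷ chain-++⁺ c d

chain-++⁻ˡ : ∀ {R q} p {r} → Chain R q (p ++ r) → Chain R q p
chain-++⁻ˡ []      _       = []
chain-++⁻ˡ (b ∷ p) (x ∷ c) = x ∷ chain-++⁻ˡ p c

chain-++⁻ʳ : ∀ {R q} p {r} → Chain R q (p ++ r) → Chain R (lastOr q p) r
chain-++⁻ʳ []      c       = c
chain-++⁻ʳ (b ∷ p) (x ∷ c) = chain-++⁻ʳ p c

chain-map : ∀ {R S : StepRel} → (∀ {q b} → R q b → S q b) → ∀ {q p} → Chain R q p → Chain S q p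
chain-map f []      = []
chain-map f (x ∷ c) = f x ∷ chain-map f c

chain-zip : ∀ {R : StepRel} {P : ℕ → Set} {q p} →
  Chain R q p → All P p → Chain (λ q b → R q b × P b) q p
chain-zip []      []       = []
chain-zip (x ∷ c) (y ∷ ys) = (x , y) ∷ chain-zip c ys

chain⇒All : ∀ {R : StepRel} {P : ℕ → Set} → (∀ {q b} → R q b → P b) → ∀ {q p} → Chain R q p → All P p
chain⇒All f []      = []
chain⇒All f (x ∷ c) = f x ∷ chain⇒All f c

All⇒chain : ∀ {P : ℕ → Set} {q p} → All P p → Chain (λ _ → P) q p
All⇒chain []       = []
All⇒chain (x ∷ xs) = x ∷ All⇒chain xs

-- Weakly monotone chains and their reversal

Prev : (ℕ → ℕ → Set) → StepRel
Prev S q b = Maybe.All (λ a → S a b) q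

Down Up : StepRel
Down = Prev _≥_
Up   = Prev _≤_

down? : ∀ q b → Dec (Down q b)
down? q b = Maybe.dec (b ≤?_) q

up? : ∀ q b → Dec (Up q b)
up? q b = Maybe.dec (_≤? b) q

Prev-any : ∀ {S q p} → Chain (Prev S) q p → Chain (Prev S) nothing p
Prev-any []      = []
Prev-any (_ ∷ c) = Maybe.nothing ∷ c

chain-reverse : ∀ {S} p → Chain (Prev S) nothing p → Chain (Prev (flip S)) nothing (reverse p)
chain-reverse [] [] = []
chain-reverse {S} (a ∷ p) (_ ∷ c) = subst (Chain _ nothing) (sym (unfold-reverse a p))
  (chain-++⁺ (chain-reverse p (Prev-any c)) (junction p c ∷ []))
  where
  junction : ∀ p → Chain (Prev S) (just a) p → Prev (flip S) (lastOr nothing (reverse p)) a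
  junction [] [] = Maybe.nothing
  junction (b ∷ p) (Maybe.just s ∷ _) rewrite lastOr-reverse nothing b p = Maybe.just s

down-bounded : ∀ {a p} → Chain Down (just a) p → All (_≤ a) p
down-bounded [] = []
down-bounded (Maybe.just b≤a ∷ c) = b≤a ∷ All.map (λ d≤b → ≤-trans d≤b b≤a) (down-bounded c)

up-bounded : ∀ {a p} → Chain Up (just a) p → All (a ≤_) p
up-bounded [] = []
up-bounded (Maybe.just a≤b ∷ c) = a≤b ∷ All.map (≤-trans a≤b) (up-bounded c)

≤last⇒≤all : ∀ {b q p} → Chain Down q p → Down (lastOr q p) b → All (b ≤_) p × Down q b
≤last⇒≤all [] b≤q = [] , b≤q
≤last⇒≤all (c≤q ∷ c) b≤l with ≤last⇒≤all c b≤l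
... | bs , Maybe.just b≤c = b≤c ∷ bs , Maybe.map (≤-trans b≤c) c≤q

≤all⇒≤last : ∀ {b q p} → Down q b → All (b ≤_) p → Down (lastOr q p) b
≤all⇒≤last b≤q []         = b≤q
≤all⇒≤last b≤q (b≤c ∷ bs) = ≤all⇒≤last (Maybe.just b≤c) bs

down-last≤ : ∀ {x p} → Chain Down (just x) p → ∀ {c} → x < c → ¬ Down (lastOr (just x) p) c
down-last≤ [] x<c (Maybe.just c≤x) = <⇒≱ x<c c≤x
down-last≤ (Maybe.just b≤x ∷ ch) x<c = down-last≤ ch (≤-<-trans b≤x x<c)

All-reverse : ∀ {P : ℕ → Set} {p} → All P p → All P (reverse p)
All-reverse {p = p} = All-resp-↭ (↭-sym (↭-reverse p))

reverse-∷ : ∀ y (p : Word) → ∃₂ λ Y r → reverse (y ∷ p) ≡ Y ∷ r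
reverse-∷ y p with reverse (y ∷ p) in eq
... | Y ∷ r = Y , r , refl
... | [] with reverse-injective {x = y ∷ p} {y = []} eq
...   | ()

-- Insertion of an H-word

Slot : ℕ → StepRel
Slot y q b = Down q b × y ≤ b

-- A ++ B and A ++ (x ∷ zs) ++ reverse (y ∷ P) ++ B are read from right to left: they are the
-- reversals of the words after and before the cut, the cut factor being y ∷ P ++ reverse (x ∷ zs).
record Site (A : Word) (x : ℕ) (zs : Word) (y : ℕ) (P B : Word) : Set where
  constructor site
  field
    down-A  : Chain Down nothing A
    y≤A     : All (y ≤_) A
    down-zs : Chain Down (just x) zs
    down-P  : Chain Down (just y) P
    x<yP    : All (x <_) (y ∷ P)
    -- The next letter breaks the run `A` or lies below `y`. Seen in the word without the factor,
    -- this fixes the place of insertion; seen in the word with it, it says that the factor cannot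
    -- be prolonged past `y` by a letter at most q.
    slot    : Stop (Slot y) (lastOr nothing A) B

  x<y : x < y
  x<y = All.head x<yP

  chain-slot : Chain (Slot y) nothing A
  chain-slot = chain-zip down-A y≤A

  stop-zs : ∀ {q} → Stop (λ _ b → x < b) q zs
  stop-zs with down-zs
  ... | [] = []
  ... | Maybe.just z≤x ∷ _ = blocked λ x<z → <⇒≱ x<z z≤x

  down-Axzs : Chain Down nothing (A ++ x ∷ zs)
  down-Axzs = chain-++⁺ down-A
    (≤all⇒≤last Maybe.nothing (All.map (≤-trans (<⇒≤ x<y)) y≤A) ∷ down-zs)

  down-yPzs : Chain Down nothing ((y ∷ P) ++ zs)
  down-yPzs = Maybe.nothing ∷ chain-++⁺ down-P (link down-zs)
    where
    link : ∀ {p} → Chain Down (just x) p → Chain Down (lastOr (just y) P) p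
    link [] = []
    link (Maybe.just z≤x ∷ c) =
      ≤all⇒≤last (Maybe.just (≤-trans z≤x (<⇒≤ x<y)))
        (All.map (λ x<b → ≤-trans z≤x (<⇒≤ x<b)) (All.tail x<yP)) ∷ c

  -- This is the letter y_r, where the descent read from the right breaks off. It separates the
  -- letters of `A`, which are at least `first`, from `x`, which is below it.
  first : ℕ
  first = proj₁ (reverse-∷ y P)

  rest : Word
  rest = proj₁ (proj₂ (reverse-∷ y P))

  reverse-P : reverse (y ∷ P) ≡ first ∷ rest
  reverse-P = proj₂ (proj₂ (reverse-∷ y P))

  x<first : x < first
  x<first = All.head (subst (All (x <_)) reverse-P (All-reverse x<yP))

  first≤y : first ≤ y
  first≤y = All.head (subst (All (_≤ y)) reverse-P (All-reverse (≤-refl ∷ down-bounded down-P)))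

  first≤A : All (first ≤_) A
  first≤A = All.map (≤-trans first≤y) y≤A

  stop-ascent : Stop Down (lastOr nothing (A ++ x ∷ zs)) (reverse (y ∷ P) ++ B)
  stop-ascent rewrite lastOr-++ nothing A {x ∷ zs} | reverse-P = blocked (down-last≤ down-zs x<first)

  -- `lastOr nothing A` is the letter q of the cut, with `nothing` for infinity. The bound by q
  -- holds because no letter of the rise exceeds `y`, and `y` is at most every letter of `A`.
  chain-rise : Chain (λ q b → Up q b × Down (lastOr nothing A) b) nothing (reverse (y ∷ P))
  chain-rise = chain-zip (chain-reverse (y ∷ P) (Maybe.nothing ∷ down-P))
    (All-reverse (All.map (λ b≤y → ≤all⇒≤last Maybe.nothing (All.map (≤-trans b≤y) y≤A))
      (≤-refl ∷ down-bounded down-P)))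

  stop-rise : Stop (λ q b → Up q b × Down (lastOr nothing A) b) (lastOr nothing (reverse (y ∷ P))) B
  stop-rise rewrite lastOr-reverse nothing y P = go slot
    where
    go : ∀ {r} → Stop (Slot y) (lastOr nothing A) r →
      Stop (λ q b → Up q b × Down (lastOr nothing A) b) (just y) r
    go []          = []
    go (blocked ban) = blocked λ { (Maybe.just y≤b , b≤l) → ban (b≤l , y≤b) }

data Insert : Word → Word → Word → Set where
  insert : ∀ {A x zs y P B} → Site A x zs y P B →
    Insert (x ∷ (y ∷ P) ++ zs) (A ++ B) (A ++ (x ∷ zs) ++ reverse (y ∷ P) ++ B)

-- Existence and uniqueness of insertions and cuts

Linked⇒chain : ∀ {p} → Linked _≥_ p → Chain Down nothing p
Linked⇒chain [] = []
Linked⇒chain [-] = Maybe.nothing ∷ []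
Linked⇒chain (a≥b ∷ l) with Linked⇒chain l
... | _ ∷ c = Maybe.nothing ∷ Maybe.just a≥b ∷ c

chain⇒Linked : ∀ {p} → Chain Down nothing p → Linked _≥_ p
chain⇒Linked [] = []
chain⇒Linked (_ ∷ []) = [-]
chain⇒Linked (_ ∷ Maybe.just a≥b ∷ c) = a≥b ∷ chain⇒Linked (Maybe.nothing ∷ c)

HWord⇒chain : ∀ {x y t} → HWord (x ∷ y ∷ t) → x < y × Chain Down nothing (y ∷ t)
HWord⇒chain (hword x<y (inj₁ refl)) = x<y , Maybe.nothing ∷ []
HWord⇒chain (hword x<y (inj₂ l))    = x<y , Linked⇒chain l

insert-HWord : ∀ {h W V} → Insert h W V → HWord h
insert-HWord (insert s) = hword (Site.x<y s) (inj₂ (chain⇒Linked (Site.down-yPzs s)))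

-- The letters after `x` are nonincreasing, so those greater than `x` form a prefix `y ∷ P`,
-- nonempty because `x < y`. The maximal `Slot y` prefix of `W` is the required `A`.
insert-exists : ∀ {h} → HWord h → ∀ W → ∃ (Insert h W)
insert-exists {x ∷ y ∷ t} hw W
  with HWord⇒chain hw
... | x<y , down-t
  with maximal-chain-exists {λ _ b → x < b} (λ _ b → x <? b) nothing (y ∷ t)
     | maximal-chain-exists {Slot y} (λ q b → down? q b ×-dec (y ≤? b)) nothing W
... | [] , _ , refl , [] , blocked ¬x<y | _ = ⊥-elim (¬x<y x<y)
... | _ ∷ P , zs , refl , x<yP , stop-zs | A , B , refl , chain-A , stop-B = _ , insert record
  { down-A  = chain-map proj₁ chain-A
  ; y≤A     = chain⇒All proj₂ chain-A
  ; down-zs = link (Prev-any (chain-++⁻ʳ (y ∷ P) down-t)) stop-zs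
  ; down-P  = down-tail (chain-++⁻ˡ (y ∷ P) down-t)
  ; x<yP    = chain⇒All (λ x<b → x<b) x<yP
  ; slot    = stop-B
  }
  where
  link : ∀ {q p} → Chain Down nothing p → Stop (λ _ b → x < b) q p → Chain Down (just x) p
  link [] _ = []
  link (_ ∷ c) (blocked x≮z) = Maybe.just (≮⇒≥ x≮z) ∷ c

  down-tail : ∀ {y P} → Chain Down nothing (y ∷ P) → Chain Down (just y) P
  down-tail (_ ∷ c) = c

insert-functional : ∀ {h h′ W W′ V V′} → Insert h W V → Insert h′ W′ V′ → h ≡ h′ → W ≡ W′ → V ≡ V′
insert-functional (insert s) (insert s′) h≡h′ W≡W′
  with ∷-injective h≡h′
... | refl , eq
  with maximal-chain-unique {λ _ b → _ < b} {nothing}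
         (All⇒chain (Site.x<yP s)) (Site.stop-zs s) (All⇒chain (Site.x<yP s′)) (Site.stop-zs s′) eq
... | refl , refl
  with maximal-chain-unique (Site.chain-slot s) (Site.slot s) (Site.chain-slot s′) (Site.slot s′) W≡W′
... | refl , refl = refl

-- Four readings of `V` from the right recover the pieces: the maximal descent is `A ++ x ∷ zs`; the
-- letter after it is `first`; the letters of the descent before one drops below `first` form `A`;
-- the maximal rise bounded by the last letter of `A` is `reverse (y ∷ P)`.
insert-cofunctional : ∀ {h h′ W W′ V V′} → Insert h W V → Insert h′ W′ V′ → V ≡ V′ → h ≡ h′ × W ≡ W′
insert-cofunctional (insert {A} {x} {zs} {y} {P} {B} s) (insert {A′} {x′} {zs′} {y′} {P′} {B′} s′) V≡V′
  with maximal-chain-unique (Site.down-Axzs s) (Site.stop-ascent s) (Site.down-Axzs s′) (Site.stop-ascent s′)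
         (trans (++-assoc A _ _) (trans V≡V′ (sym (++-assoc A′ _ _))))
... | eq₁ , eq₂
  with ∷-injectiveˡ (subst₂ (λ u v → u ++ B ≡ v ++ B′) (Site.reverse-P s) (Site.reverse-P s′) eq₂)
... | first≡
  with maximal-chain-unique {λ _ b → Site.first s ≤ b} {nothing}
         (All⇒chain (Site.first≤A s)) (blocked (<⇒≱ (Site.x<first s)))
         (All⇒chain (subst (λ f → All (f ≤_) A′) (sym first≡) (Site.first≤A s′)))
         (blocked (<⇒≱ (subst (_ <_) (sym first≡) (Site.x<first s′)))) eq₁
... | refl , refl
  with maximal-chain-unique (Site.chain-rise s) (Site.stop-rise s) (Site.chain-rise s′) (Site.stop-rise s′) eq₂
... | eq₃ , refl
  with reverse-injective {x = y ∷ P} {y = y′ ∷ P′} eq₃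
... | refl = refl , refl

-- The maximal descent of `V` stops at `first`, hence before the end of `V`.
insert-not-down : ∀ {h W V} → Insert h W V → ¬ Chain Down nothing V
insert-not-down (insert {A} {x} {zs} {y} {P} {B} s) c
  with maximal-chain-unique {r′ = []} (Site.down-Axzs s) (Site.stop-ascent s) c []
         (trans (++-assoc A _ _) (sym (++-identityʳ _)))
... | _ , eq with trans (cong (_++ B) (sym (Site.reverse-P s))) eq
...   | ()

insert-↭ : ∀ {h W V} → Insert h W V → V ↭ h ++ W
insert-↭ (insert {A} {x} {zs} {y} {P} {B} s) = begin
  A ++ (x ∷ zs) ++ reverse (y ∷ P) ++ B  ↭⟨ ++⁺ˡ A (++⁺ˡ (x ∷ zs) (++⁺ʳ B (↭-reverse (y ∷ P)))) ⟩
  A ++ (x ∷ zs) ++ (y ∷ P) ++ B          ↭⟨ ++⁺ˡ A (prep x (shifts zs (y ∷ P))) ⟩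
  A ++ x ∷ (y ∷ P) ++ zs ++ B            ≡⟨ cong (λ r → A ++ x ∷ r) (++-assoc (y ∷ P) zs B) ⟨
  A ++ (x ∷ (y ∷ P) ++ zs) ++ B          ↭⟨ shifts A (x ∷ (y ∷ P) ++ zs) ⟩
  (x ∷ (y ∷ P) ++ zs) ++ A ++ B          ∎
  where open PermutationReasoning

-- The readings that make the cut unique also perform it, as soon as the maximal descent leaves a
-- remainder `Y ∷ T`.
uninsert : ∀ V → Chain Down nothing V ⊎ ∃₂ λ h W → Insert h W V
uninsert V with maximal-chain-exists down? nothing V
... | R , [] , refl , c , _ = inj₁ (subst (Chain Down nothing) (sym (++-identityʳ R)) c)
... | R , Y ∷ T , refl , down-R , blocked Y≰
  with maximal-chain-exists {λ _ b → Y ≤ b} (λ _ b → Y ≤? b) nothing R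
-- If every letter of the descent were at least `Y`, the descent would continue through `Y`.
... | A , [] , refl , Y≤A , [] = ⊥-elim (Y≰ (subst (λ w → Down (lastOr nothing w) Y) (sym (++-identityʳ A))
        (≤all⇒≤last Maybe.nothing (chain⇒All (λ Y≤b → Y≤b) Y≤A))))
... | A , x ∷ zs , refl , Y≤A , blocked Y≰x
  with maximal-chain-exists {λ q b → Up q b × Down (lastOr nothing A) b}
         (λ q b → up? q b ×-dec down? (lastOr nothing A) b) nothing (Y ∷ T)
... | [] , _ , refl , _ , blocked ban =
        ⊥-elim (ban (Maybe.nothing , ≤all⇒≤last Maybe.nothing (chain⇒All (λ Y≤b → Y≤b) Y≤A)))
... | _ ∷ ys , B , refl , rise@(_ ∷ rise′) , stop-B
  with reverse-∷ Y ys
... | y , P , eq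
  = inj₂ (_ , _ , subst (Insert _ _) V≡ (insert record
      { down-A  = down-A
      -- The rise ends in `y`, so `y` is at most the last letter of `A`, which is the least one.
      ; y≤A     = proj₁ (≤last⇒≤all down-A (All.head (subst (All _) eq (All-reverse (chain⇒All proj₂ rise)))))
      ; down-zs = down-tail (chain-++⁻ʳ A down-R)
      ; down-P  = down-tail (subst (Chain Down nothing) eq (chain-reverse (Y ∷ ys) (chain-map proj₁ rise)))
      ; x<yP    = subst (All (x <_)) eq
                    (All-reverse (All.map (<-≤-trans (≰⇒> Y≰x)) (≤-refl ∷ up-bounded (chain-map proj₁ rise′))))
      ; slot    = convert (subst (λ q → Stop _ q B) last≡ stop-B)
      }))
  where
  down-A : Chain Down nothing A
  down-A = chain-++⁻ˡ A down-R

  down-tail : ∀ {q y P} → Chain Down q (y ∷ P) → Chain Down (just y) P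
  down-tail (_ ∷ c) = c

  ys≡ : reverse (y ∷ P) ≡ Y ∷ ys
  ys≡ = trans (cong reverse (sym eq)) (reverse-involutive (Y ∷ ys))

  V≡ : A ++ (x ∷ zs) ++ reverse (y ∷ P) ++ B ≡ (A ++ x ∷ zs) ++ Y ∷ ys ++ B
  V≡ = trans (cong (λ w → A ++ (x ∷ zs) ++ w ++ B) ys≡) (sym (++-assoc A (x ∷ zs) _))

  last≡ : lastOr nothing (Y ∷ ys) ≡ just y
  last≡ = trans (cong (lastOr nothing) (sym ys≡)) (lastOr-reverse nothing y P)

  convert : ∀ {r} → Stop (λ q b → Up q b × Down (lastOr nothing A) b) (just y) r →
    Stop (Slot y) (lastOr nothing A) r
  convert []          = []
  convert (blocked ban) = blocked λ { (b≤l , y≤b) → ban (Maybe.just y≤b , b≤l) }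

length-uninsert : ∀ {h W V} → Insert h W V → length W < length V
length-uninsert {h} {W} i@(insert _) = subst (length W <_)
  (sym (trans (↭-length (insert-↭ i)) (length-++ h))) (s≤s (m≤n+m (length W) _))

-- Iterated insertion

data Build : Word → Word → List Word → Set where
  base : ∀ {u} → Chain Down nothing u → Build u u []
  add  : ∀ {h hs u W V} → Insert h W V → Build W u hs → Build V u (h ∷ hs)

build-exists : ∀ {u hs} → Linked _≥_ u → All HWord hs → ∃ λ V → Build V u hs
build-exists l [] = _ , base (Linked⇒chain l)
build-exists l (hw ∷ hws) with build-exists l hws
... | W , b with insert-exists hw W
...   | V , i = V , add i b

build-functional : ∀ {u hs V V′} → Build V u hs → Build V′ u hs → V ≡ V′
build-functional (base _)  (base _)    = refl
build-functional (add i b) (add i′ b′) = insert-functional i i′ refl (build-functional b b′)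

-- A word produced by an insertion is never descending, so `V` itself tells whether another cut is
-- due.
build-cofunctional : ∀ {u hs u′ hs′ V} → Build V u hs → Build V u′ hs′ → u ≡ u′ × hs ≡ hs′
build-cofunctional (base _)  (base _)    = refl , refl
build-cofunctional (base c)  (add i _)   = ⊥-elim (insert-not-down i c)
build-cofunctional (add i _) (base c)    = ⊥-elim (insert-not-down i c)
build-cofunctional (add i b) (add i′ b′) with insert-cofunctional i i′ refl
... | refl , refl with build-cofunctional b b′
...   | refl , refl = refl , refl

decompose : ∀ V → ∃₂ λ u hs → Build V u hs
decompose V = go V (<-wellFounded (length V))
  where
  go : ∀ V → Acc _<_ (length V) → ∃₂ λ u hs → Build V u hs
  go V (acc rec) with uninsert V
  ... | inj₁ c = V , [] , base c
  ... | inj₂ (h , W , i) with go W (rec (length-uninsert i))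
  ...   | u , hs , b = u , h ∷ hs , add i b

build-↭ : ∀ {V u hs} → Build V u hs → V ↭ u ++ concat hs
build-↭ {u = u} (base _) = ↭-reflexive (sym (++-identityʳ u))
build-↭ {u = u} (add {h} {hs} {W = W} {V} i b) = begin
  V                       ↭⟨ insert-↭ i ⟩
  h ++ W                  ↭⟨ ++⁺ˡ h (build-↭ b) ⟩
  h ++ u ++ concat hs     ↭⟨ shifts h u ⟩
  u ++ h ++ concat hs     ∎
  where open PermutationReasoning

build-HFactorization : ∀ {V u hs} → Build V u hs → HFactorization (u ++ concat hs) u hs
build-HFactorization b = refl , start b , hwords b
  where
  start : ∀ {V u hs} → Build V u hs → Linked _≥_ u
  start (base c)  = chain⇒Linked c
  start (add _ b) = start b

  hwords : ∀ {V u hs} → Build V u hs → All HWord hs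
  hwords (base _)  = []
  hwords (add i b) = insert-HWord i ∷ hwords b

-- Uniqueness of the factorization into H-words

push : ℕ → Word × List Word → Word × List Word
push x ([] , hs) = [ x ] , hs
push x (y ∷ u , hs) with y ≤? x
... | yes _ = x ∷ y ∷ u , hs
... | no  _ = [] , (x ∷ y ∷ u) ∷ hs

-- Reading from the right, an H-word is closed exactly at an ascent.
parse : Word → Word × List Word
parse = foldr push ([] , [])

push-≤ : ∀ {x y u hs} → y ≤ x → push x (y ∷ u , hs) ≡ (x ∷ y ∷ u , hs)
push-≤ {x} {y} y≤x with y ≤? x
... | yes _  = refl
... | no y≰x = ⊥-elim (y≰x y≤x)

push-< : ∀ {x y u hs} → x < y → push x (y ∷ u , hs) ≡ ([] , (x ∷ y ∷ u) ∷ hs)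
push-< {x} {y} x<y with y ≤? x
... | yes y≤x = ⊥-elim (<⇒≱ x<y y≤x)
... | no _    = refl

-- With nothing open to its right, a nonincreasing word starts a new open block, which no ascent
-- closes.
parse-++ : ∀ {u w hs} → Linked _≥_ u → parse w ≡ ([] , hs) → parse (u ++ w) ≡ (u , hs)
parse-++ [] eq = eq
parse-++ [-] eq rewrite eq = refl
parse-++ {x ∷ y ∷ u} (y≤x ∷ l) eq = trans (cong (push x) (parse-++ l eq)) (push-≤ y≤x)

parse-concat : ∀ {hs} → All HWord hs → parse (concat hs) ≡ ([] , hs)
parse-concat [] = refl
parse-concat (_∷_ {x ∷ y ∷ t} hw hws) with HWord⇒chain hw
... | x<y , c = trans (cong (push x) (parse-++ (chain⇒Linked c) (parse-concat hws))) (push-< x<y)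

HFactorization⇒parse : ∀ {w u hs} → HFactorization w u hs → parse w ≡ (u , hs)
HFactorization⇒parse (refl , l , hws) = parse-++ l (parse-concat hws)

HFactorization-unique : ∀ {w u hs u′ hs′} →
  HFactorization w u hs → HFactorization w u′ hs′ → u ≡ u′ × hs ≡ hs′
HFactorization-unique f f′ with trans (sym (HFactorization⇒parse f)) (HFactorization⇒parse f′)
... | refl = refl , refl

HFactorization-exists : ∀ w → ∃₂ (HFactorization w)
HFactorization-exists [] = [] , [] , refl , [] , []
HFactorization-exists (x ∷ w) with HFactorization-exists w
... | [] , hs , refl , _ , hws = [ x ] , hs , refl , [-] , hws
... | y ∷ u , hs , refl , l , hws with y ≤? x
...   | yes y≤x = x ∷ y ∷ u , hs , refl , y≤x ∷ l , hws
...   | no  y≰x = [] , (x ∷ y ∷ u) ∷ hs , refl , [] , hword (≰⇒> y≰x) (inj₂ l) ∷ hws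

-- The map and its bijectivity

transform : Word → Word
transform w with decompose (reverse w)
... | u , hs , _ = u ++ concat hs

transform-build : ∀ w → ∃₂ λ u hs → transform w ≡ u ++ concat hs × Build (reverse w) u hs
transform-build w with decompose (reverse w)
... | u , hs , b = u , hs , refl , b

-- By uniqueness, any factorization of the image is the one produced by the cuts, so its statistics
-- can be followed cut by cut.
transform-HFactorization : ∀ w {u hs} → HFactorization (transform w) u hs → Build (reverse w) u hs
transform-HFactorization w f with transform-build w
... | u , hs , eq , b with HFactorization-unique (subst (λ v → HFactorization v u hs) (sym eq) (build-HFactorization b)) f
...   | refl , refl = b

transform-↭ : ∀ w → transform w ↭ w
transform-↭ w with transform-build w
... | u , hs , eq , b = begin
  transform w     ≡⟨ eq ⟩
  u ++ concat hs  ↭⟨ build-↭ b ⟨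
  reverse w       ↭⟨ ↭-reverse w ⟩
  w               ∎
  where open PermutationReasoning

transform-injective : ∀ v w → transform v ≡ transform w → v ≡ w
transform-injective v w eq with HFactorization-exists (transform v)
... | u , hs , f = reverse-injective (build-functional (transform-HFactorization v f)
        (transform-HFactorization w (subst (λ t → HFactorization t u hs) eq f)))

transform-surjective : ∀ w → ∃ λ v → transform v ≡ w
transform-surjective w with HFactorization-exists w
... | u , hs , refl , l , hws with build-exists l hws
...   | V , b with transform-build (reverse V)
...     | u′ , hs′ , eq , b′ with build-cofunctional (subst (λ t → Build t u′ hs′) (reverse-involutive V) b′) b
...       | refl , refl = reverse V , eq

-- Decreases and records along monotone stretches

<ᵇ-true : ∀ {a b} → a < b → (a <ᵇ b) ≡ true
<ᵇ-true {a} {b} = dec-true (a <? b)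

<ᵇ-false : ∀ {a b} → b ≤ a → (a <ᵇ b) ≡ false
<ᵇ-false {a} {b} b≤a = dec-false (a <? b) (≤⇒≯ b≤a)

≤ᵇ-true : ∀ {a b} → a ≤ b → (a ≤ᵇ b) ≡ true
≤ᵇ-true {a} {b} = dec-true (a ≤? b)

≤ᵇ-false : ∀ {a b} → b < a → (a ≤ᵇ b) ≡ false
≤ᵇ-false {a} {b} b<a = dec-false (a ≤? b) (<⇒≱ b<a)

decFrom-> : ∀ {a b} r → b < a → decFrom a (b ∷ r) ≡ true
decFrom-> r b<a rewrite <ᵇ-true b<a = refl

decFrom-< : ∀ {a b} r → a < b → decFrom a (b ∷ r) ≡ false
decFrom-< {a} {b} r a<b rewrite <ᵇ-false (<⇒≤ a<b) | dec-false (a ≟ b) (<⇒≢ a<b) = refl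

decFrom-≡ : ∀ a r → decFrom a (a ∷ r) ≡ decFrom a r
decFrom-≡ a r rewrite <ᵇ-false (≤-refl {a}) | dec-true (a ≟ a) refl = refl

decFrom-cons : ∀ a b r r′ → decFrom b r ≡ decFrom b r′ → decFrom a (b ∷ r) ≡ decFrom a (b ∷ r′)
decFrom-cons a b r r′ eq rewrite eq = refl

decFrom-up : ∀ {a w} → Chain Up (just a) w → decFrom a w ≡ false
decFrom-up [] = refl
decFrom-up {a} (_∷_ {b = b} {r} (Maybe.just a≤b) c) with m≤n⇒m<n∨m≡n a≤b
... | inj₁ a<b  = decFrom-< r a<b
... | inj₂ refl = trans (decFrom-≡ a r) (decFrom-up c)

dec-up : ∀ {q w} → Chain Up q w → dec w ≡ 0
dec-up [] = refl
dec-up (_ ∷ c) rewrite decFrom-up c = dec-up c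

-- The plateau beginning at `a` ends in a strict drop, at the latest on reaching `c`.
decFrom-down : ∀ {a p c} r → Chain Down (just a) p → All (c <_) (a ∷ p) → decFrom a (p ++ c ∷ r) ≡ true
decFrom-down r [] (c<a ∷ _) = decFrom-> r c<a
decFrom-down {a} r (_∷_ {p = p} (Maybe.just b≤a) ch) (_ ∷ c<p) with m≤n⇒m<n∨m≡n b≤a
... | inj₁ b<a  = decFrom-> (p ++ _ ∷ r) b<a
... | inj₂ refl = trans (decFrom-≡ a (p ++ _)) (decFrom-down r ch c<p)

dec-down : ∀ {q p c} r → Chain Down q p → All (c <_) p → dec (p ++ c ∷ r) ≡ length p + dec (c ∷ r)
dec-down r [] _ = refl
dec-down r (_ ∷ ch) c<p rewrite decFrom-down r ch c<p = cong suc (dec-down r ch (All.tail c<p))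

-- With m = 0, the number of positions that are not decreases and whose letter is at least every
-- earlier letter; these are the one-letter Lyndon factors.
records : ℕ → Word → ℕ
records m []      = 0
records m (a ∷ r) = (if m ≤ᵇ a then (if decFrom a r then 0 else 1) else 0) + records (m ⊔ a) r

records-decrease : ∀ m {a} r → decFrom a r ≡ true → records m (a ∷ r) ≡ records (m ⊔ a) r
records-decrease m {a} r eq rewrite eq with m ≤ᵇ a
... | true  = refl
... | false = refl

records-small : ∀ {m p} r → All (_< m) p → records m (p ++ r) ≡ records m r
records-small r [] = refl
records-small {m} r (a<m ∷ as) rewrite ≤ᵇ-false a<m | m≥n⇒m⊔n≡m (<⇒≤ a<m) = records-small r as

records-down : ∀ {m q p c} r → Chain Down q p → All (c <_) p → All (_≤ m) p →
  records m (p ++ c ∷ r) ≡ records m (c ∷ r)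
records-down r [] _ _ = refl
records-down {m} {c = c} r (_∷_ {p = p} _ ch) c<p (a≤m ∷ as) =
  trans (records-decrease m (p ++ c ∷ r) (decFrom-down r ch c<p))
    (trans (cong (λ n → records n (p ++ c ∷ r)) (m≥n⇒m⊔n≡m a≤m)) (records-down r ch (All.tail c<p) as))

-- If `m ≤ y`, the first letter passes both thresholds and then replaces them, so only that letter
-- has to be examined. If `y ≤ m`, the thresholds agree.
records-large : ∀ m {y w} → All (y ≤_) w → records (m ⊔ y) w ≡ records m w
records-large m [] = refl
records-large m {y} (_∷_ {a} y≤a _) with ≤-total y m
... | inj₁ y≤m rewrite m≥n⇒m⊔n≡m y≤m = refl
... | inj₂ m≤y rewrite m≤n⇒m⊔n≡n m≤y | ≤ᵇ-true y≤a | ≤ᵇ-true (≤-trans m≤y y≤a)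
                     | m≤n⇒m⊔n≡n y≤a | m≤n⇒m⊔n≡n (≤-trans m≤y y≤a) = refl

-- Effect of one cut on decreases and records

record Effect (w : Word) (n : ℕ) (w′ : Word) : Set where
  constructor effect
  field
    decs : dec w ≡ n + dec w′
    -- All thresholds are included because a common prefix raises the initial one.
    recs : ∀ m → records m w ≡ records m w′

effect-cons : ∀ {r n r′} a → decFrom a r ≡ decFrom a r′ → Effect r n r′ → Effect (a ∷ r) n (a ∷ r′)
effect-cons {r} {n} {r′} a eq (effect decs recs) = effect decs′ recs′
  where
  decs′ : dec (a ∷ r) ≡ n + dec (a ∷ r′)
  decs′ rewrite eq | decs with decFrom a r′
  ... | true  = sym (+-suc n _)
  ... | false = refl

  recs′ : ∀ m → records m (a ∷ r) ≡ records m (a ∷ r′)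
  recs′ m rewrite eq | recs (m ⊔ a) = refl

-- Whether a letter is a decrease depends on what follows only through the next letter and that
-- letter's own `decFrom`. Hence only `b`, adjacent to the change, has to be checked.
effect-context : ∀ {r n r′ b} q → decFrom b r ≡ decFrom b r′ → Effect r n r′ → Effect (q ++ b ∷ r) n (q ++ b ∷ r′)
effect-context []      eq e = effect-cons _ eq e
effect-context {r} {n} {r′} {b} (a ∷ q) eq e = effect-cons a (same a q) (effect-context q eq e)
  where
  same : ∀ a q → decFrom a (q ++ b ∷ r) ≡ decFrom a (q ++ b ∷ r′)
  same a []      = decFrom-cons a b r r′ eq
  same a (c ∷ q) = decFrom-cons a c (q ++ b ∷ r) (q ++ b ∷ r′) (same c q)

count>-low : ∀ {a w} → All (a ≤_) w → count> a w ≡ 0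
count>-low [] = refl
count>-low (a≤b ∷ as) rewrite <ᵇ-false a≤b = count>-low as

count>-snoc : ∀ {a x w} → All (a ≤_) w → x < a → count> a (w ++ [ x ]) ≡ 1
count>-snoc [] x<a rewrite <ᵇ-true x<a = refl
count>-snoc (a≤b ∷ as) x<a rewrite <ᵇ-false a≤b = count>-snoc as x<a

inv-high : ∀ {q p x} → Chain Up q p → All (x <_) p → inv (p ++ [ x ]) ≡ length p
inv-high [] [] = refl
inv-high (_ ∷ c) (x<a ∷ xs) rewrite count>-snoc (up-bounded c) x<a = cong suc (inv-high c xs)

inv-low : ∀ {q x} p {r} → Chain Up q (p ++ r) → All (_≤ x) p → inv ((p ++ r) ++ [ x ]) ≡ inv (r ++ [ x ])
inv-low [] c [] = refl
inv-low (a ∷ p) (_ ∷ c) (a≤x ∷ as)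
  rewrite count>-low (++⁺ (up-bounded c) (a≤x ∷ [])) = inv-low p c as

-- Reversed, the H-word is weakly ascending except for its final `x`, so its inversions are the
-- pairs of a letter of `y ∷ P` with `x`.
insert-inv : ∀ {A x zs y P B} → Site A x zs y P B → inv (reverse (x ∷ (y ∷ P) ++ zs)) ≡ length (y ∷ P)
insert-inv {A} {x} {zs} {y} {P} s = begin
  inv (reverse (x ∷ (y ∷ P) ++ zs))                 ≡⟨ cong inv (unfold-reverse x ((y ∷ P) ++ zs)) ⟩
  inv (reverse ((y ∷ P) ++ zs) ++ [ x ])            ≡⟨ cong (λ w → inv (w ++ [ x ])) (reverse-++ (y ∷ P) zs) ⟩
  inv ((reverse zs ++ reverse (y ∷ P)) ++ [ x ])    ≡⟨ inv-low (reverse zs) up (All-reverse (down-bounded down-zs)) ⟩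
  inv (reverse (y ∷ P) ++ [ x ])                    ≡⟨ inv-high (chain-++⁻ʳ (reverse zs) up) (All-reverse x<yP) ⟩
  length (reverse (y ∷ P))                          ≡⟨ length-reverse (y ∷ P) ⟩
  length (y ∷ P)                                    ∎
  where
  open Site s
  open ≡-Reasoning
  up : Chain Up nothing (reverse zs ++ reverse (y ∷ P))
  up = subst (Chain Up nothing) (reverse-++ (y ∷ P) zs) (chain-reverse ((y ∷ P) ++ zs) down-yPzs)

-- The letters of `y ∷ P` are decreases, and the ascent after them has none. For records, `y` only
-- raises the threshold: `P` consists of decreases not above `y`, `x ∷ zs` lies below `y`, and the
-- letters of `A` are at least `y`, so the raise does not affect them.
insert-effect-core : ∀ {A x zs y P B} → Site A x zs y P B →
  Effect ((y ∷ P) ++ reverse (x ∷ zs) ++ reverse A) (length (y ∷ P)) (reverse A)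
-- `Z` is the letter z₁ to which the descent `y ∷ P` drops.
insert-effect-core {A} {x} {zs} {y} {P} s with reverse-∷ x zs
... | Z , r , eq = effect decs recs
  where
  open Site s
  open ≡-Reasoning

  up : Chain Up nothing (reverse (x ∷ zs) ++ reverse A)
  up = subst (Chain Up nothing) (reverse-++ A (x ∷ zs)) (chain-reverse (A ++ x ∷ zs) down-Axzs)

  ≤x : All (_≤ x) (Z ∷ r)
  ≤x = subst (All (_≤ x)) eq (All-reverse (≤-refl ∷ down-bounded down-zs))

  Z<yP : All (Z <_) (y ∷ P)
  Z<yP = All.map (≤-<-trans (All.head ≤x)) x<yP

  decs : dec ((y ∷ P) ++ reverse (x ∷ zs) ++ reverse A) ≡ length (y ∷ P) + dec (reverse A)
  decs = begin
    dec ((y ∷ P) ++ reverse (x ∷ zs) ++ reverse A)        ≡⟨ cong (λ w → dec ((y ∷ P) ++ w ++ reverse A)) eq ⟩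
    dec ((y ∷ P) ++ Z ∷ r ++ reverse A)                   ≡⟨ dec-down {nothing} _ (Maybe.nothing ∷ down-P) Z<yP ⟩
    length (y ∷ P) + dec (Z ∷ r ++ reverse A)             ≡⟨ cong (λ w → length (y ∷ P) + dec (w ++ reverse A)) eq ⟨
    length (y ∷ P) + dec (reverse (x ∷ zs) ++ reverse A)  ≡⟨ cong (length (y ∷ P) +_) (dec-up up) ⟩
    length (y ∷ P) + 0                                    ≡⟨ cong (length (y ∷ P) +_) (dec-up (chain-++⁻ʳ (reverse (x ∷ zs)) up)) ⟨
    length (y ∷ P) + dec (reverse A)                      ∎

  recs : ∀ m → records m ((y ∷ P) ++ reverse (x ∷ zs) ++ reverse A) ≡ records m (reverse A)
  recs m = begin
    records m ((y ∷ P) ++ reverse (x ∷ zs) ++ reverse A)  ≡⟨ cong (λ w → records m ((y ∷ P) ++ w ++ reverse A)) eq ⟩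
    records m (y ∷ P ++ Z ∷ r ++ reverse A)               ≡⟨ records-decrease m (P ++ Z ∷ r ++ reverse A) (decFrom-down (r ++ reverse A) down-P Z<yP) ⟩
    records (m ⊔ y) (P ++ Z ∷ r ++ reverse A)             ≡⟨ records-down _ down-P (All.tail Z<yP)
                                                               (All.map (λ b≤y → ≤-trans b≤y (m≤n⊔m m y)) (down-bounded down-P)) ⟩
    records (m ⊔ y) ((Z ∷ r) ++ reverse A)                ≡⟨ records-small (reverse A)
                                                               (All.map (λ b≤x → ≤-trans (s≤s b≤x) (≤-trans x<y (m≤n⊔m m y))) ≤x) ⟩
    records (m ⊔ y) (reverse A)                           ≡⟨ records-large m (All-reverse y≤A) ⟩
    records m (reverse A)                                 ∎

-- Here `b` stands just left of the cut factor. Maximality of `A` leaves two cases: `b < y`, where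
-- `b` is a decrease neither before nor after the cut, and `b` greater than the first letter of
-- `reverse A`, hence than `y`, where it is a decrease both times.
slot-decFrom : ∀ {A x zs y P b B} → Site A x zs y P (b ∷ B) → ∀ t →
  decFrom b (y ∷ t) ≡ decFrom b (reverse A)
slot-decFrom {A} {y = y} {b = b} s t with Site.slot s | reverse A in eq | All-reverse (Site.y≤A s) | b <? y
... | _ | [] | _ | yes b<y = decFrom-< t b<y
... | _ | c ∷ r | y≤c ∷ _ | yes b<y = trans (decFrom-< t b<y) (sym (decFrom-< r (<-≤-trans b<y y≤c)))
... | blocked ban | [] | _ | no b≮y =
        ⊥-elim (ban (subst (λ A → Down (lastOr nothing A) b) (sym (reverse-injective {x = A} {y = []} eq)) Maybe.nothing , ≮⇒≥ b≮y))
... | blocked ban | c ∷ r | y≤c ∷ _ | no b≮y = trans (decFrom-> t (≤-<-trans y≤c c<b)) (sym (decFrom-> r c<b))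
  where
  last≡ : lastOr nothing A ≡ just c
  last≡ = trans (cong (lastOr nothing) (trans (sym (reverse-involutive A)) (cong reverse eq))) (lastOr-reverse nothing c r)

  c<b : c < b
  c<b = ≰⇒> λ b≤c → ban (subst (λ q → Down q b) (sym last≡) (Maybe.just b≤c) , ≮⇒≥ b≮y)

insert-effect : ∀ {h W V} → Insert h W V → Effect (reverse V) (inv (reverse h)) (reverse W)
insert-effect (insert {A} {x} {zs} {y} {P} {B} s) rewrite insert-inv s =
  subst₂ (λ v w → Effect v (length (y ∷ P)) w) (sym V≡) (sym (reverse-++ A B)) (under-B s)
  where
  open ≡-Reasoning
  core : Word
  core = (y ∷ P) ++ reverse (x ∷ zs) ++ reverse A

  V≡ : reverse (A ++ (x ∷ zs) ++ reverse (y ∷ P) ++ B) ≡ reverse B ++ core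
  V≡ = begin
    reverse (A ++ (x ∷ zs) ++ reverse (y ∷ P) ++ B)
      ≡⟨ reverse-++ A _ ⟩
    reverse ((x ∷ zs) ++ reverse (y ∷ P) ++ B) ++ reverse A
      ≡⟨ cong (_++ reverse A) (reverse-++ (x ∷ zs) _) ⟩
    (reverse (reverse (y ∷ P) ++ B) ++ reverse (x ∷ zs)) ++ reverse A
      ≡⟨ ++-assoc (reverse (reverse (y ∷ P) ++ B)) _ _ ⟩
    reverse (reverse (y ∷ P) ++ B) ++ reverse (x ∷ zs) ++ reverse A
      ≡⟨ cong (_++ reverse (x ∷ zs) ++ reverse A) (reverse-++ (reverse (y ∷ P)) B) ⟩
    (reverse B ++ reverse (reverse (y ∷ P))) ++ reverse (x ∷ zs) ++ reverse A
      ≡⟨ ++-assoc (reverse B) _ _ ⟩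
    reverse B ++ reverse (reverse (y ∷ P)) ++ reverse (x ∷ zs) ++ reverse A
      ≡⟨ cong (λ w → reverse B ++ w ++ reverse (x ∷ zs) ++ reverse A) (reverse-involutive (y ∷ P)) ⟩
    reverse B ++ core
      ∎

  under-B : ∀ {B} → Site A x zs y P B → Effect (reverse B ++ core) (length (y ∷ P)) (reverse B ++ reverse A)
  under-B {[]} s = insert-effect-core s
  under-B {b ∷ B} s rewrite unfold-reverse b B | ++-assoc (reverse B) [ b ] core | ++-assoc (reverse B) [ b ] (reverse A) =
    effect-context (reverse B) (slot-decFrom s (P ++ reverse (x ∷ zs) ++ reverse A)) (insert-effect-core s)

-- Totals over all cuts

build-dec : ∀ {V u hs} → Build V u hs → dec (reverse V) ≡ wlecOf hs
build-dec (base {u} c) = dec-up (chain-reverse u c)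
build-dec (add {h} i b) = trans (Effect.decs (insert-effect i)) (cong (inv (reverse h) +_) (build-dec b))

records-up : ∀ {m w} → Chain Up (just m) w → records m w ≡ length w
records-up [] = refl
records-up {m} (Maybe.just m≤a ∷ c) rewrite ≤ᵇ-true m≤a | decFrom-up c | m≤n⇒m⊔n≡n m≤a = cong suc (records-up c)

build-records : ∀ {V u hs} → Build V u hs → records 0 (reverse V) ≡ length u
build-records (base {u} c) = trans (records-up (from-0 (chain-reverse u c))) (length-reverse u)
  where
  from-0 : ∀ {w} → Chain Up nothing w → Chain Up (just 0) w
  from-0 []      = []
  from-0 (_ ∷ c) = Maybe.just z≤n ∷ c
build-records (add i b) = trans (Effect.recs (insert-effect i) 0) (build-records b)

-- Records and one-letter Lyndon factors

rotate-++ : ∀ (p s : Word) → rotate (length p) (p ++ s) ≡ s ++ p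
rotate-++ p s = cong₂ _++_ (drop-length p) (take-length p)
  where
  drop-length : ∀ (p : Word) → drop (length p) (p ++ s) ≡ s
  drop-length []      = refl
  drop-length (_ ∷ p) = drop-length p

  take-length : ∀ (p : Word) → take (length p) (p ++ s) ≡ p
  take-length []      = refl
  take-length (b ∷ p) = cong (b ∷_) (take-length p)

lyndon-rotation : ∀ a p {c s} → Lyndon (a ∷ p ++ c ∷ s) → LexLt (c ∷ s ++ a ∷ p) (a ∷ p ++ c ∷ s)
lyndon-rotation a [] (inj₁ ())
lyndon-rotation a (_ ∷ _) (inj₁ ())
lyndon-rotation a p {c} {s} (inj₂ (_ , greater)) =
  subst (λ w → LexLt w (a ∷ p ++ c ∷ s)) (rotate-++ (a ∷ p) (c ∷ s))
    (greater (length (a ∷ p)) (s≤s z≤n) (s≤s (subst (length p <_) (sym (length-++ p)) (m<m+n (length p) (s≤s z≤n)))))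

LexLt-head : ∀ {a b u v} → LexLt (a ∷ u) (b ∷ v) → a ≤ b
LexLt-head (lt a<b) = <⇒≤ a<b
LexLt-head (step _) = ≤-refl

LexLeq-head : ∀ {a b u v} → LexLeq (a ∷ u) (b ∷ v) → a ≤ b
LexLeq-head (lt a<b) = <⇒≤ a<b
LexLeq-head (step _) = ≤-refl

max-snoc-≮ : ∀ {a q} → All (_≤ a) q → ¬ LexLt (a ∷ q) (q ++ [ a ])
max-snoc-≮ [] (lt a<a) = <-irrefl refl a<a
max-snoc-≮ [] (step ())
max-snoc-≮ (b≤a ∷ _) (lt a<b) = <⇒≱ a<b b≤a
max-snoc-≮ (_ ∷ bs) (step l) = max-snoc-≮ bs l

data LyndonShape (a : ℕ) : Word → Set where
  single : LyndonShape a []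
  long   : ∀ {p c} → All (_≤ a) p → c < a → LyndonShape a (p ++ [ c ])

-- The rotation starting at any letter is smaller than the word, so `a` is the maximum. If the last
-- letter were `a`, moving it to the front could not make the word smaller.
lyndon-shape : ∀ a t → Lyndon (a ∷ t) → LyndonShape a t
lyndon-shape a t ly with initLast t
... | [] = single
... | p ∷ʳ′ c = long (++⁻ˡ p t≤a) (≤∧≢⇒< (All.head (++⁻ʳ p t≤a)) c≢a)
  where
  t≤a : All (_≤ a) (p ++ [ c ])
  t≤a = All.tabulate bound
    where
    bound : ∀ {b} → b ∈ p ++ [ c ] → b ≤ a
    bound b∈t with ∈-∃++ b∈t
    ... | u , v , eq = LexLt-head (lyndon-rotation a u (subst (λ t → Lyndon (a ∷ t)) eq ly))

  c≢a : ¬ c ≡ a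
  c≢a refl = max-snoc-≮ (≤-refl ∷ ++⁻ˡ p t≤a) (lyndon-rotation a p ly)

≼-head : ∀ {a b t s} → (a ∷ t) ≼ (b ∷ s) → a ≤ b
-- The exponent `suc B` makes both powers nonempty.
≼-head (B , leq) = LexLeq-head (leq (suc B) (n≤1+n B))

-- The power is long enough to reach the position of `c`; there or earlier the other word falls
-- below `a`.
power-max-≰ : ∀ {a c q r n} → length q < n → All (_≤ a) q → c < a → ¬ LexLeq ([ a ] ^w n) (q ++ c ∷ r)
power-max-≰ {n = suc n} _ [] c<a leq = <⇒≱ c<a (LexLeq-head leq)
power-max-≰ {n = suc n} _ (b≤a ∷ _) c<a (lt a<b) = <⇒≱ a<b b≤a
power-max-≰ {n = suc n} (s≤s q<n) (_ ∷ bs) c<a (step leq) = power-max-≰ q<n bs c<a leq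

≼-long : ∀ {a p c} → All (_≤ a) p → c < a → ¬ [ a ] ≼ (a ∷ p ++ [ c ])
≼-long {a} {p} {c} p≤a c<a (B , leq) =
  power-max-≰ {q = a ∷ p} (s≤s (s≤s (m≤m+n (length p) B))) (≤-refl ∷ p≤a) c<a
    (subst (LexLeq ([ a ] ^w n)) (cong (a ∷_) (++-assoc p [ c ] _))
      (leq n (≤-trans (m≤n+m B (length p)) (m≤n+m (length p + B) 2))))
  where
  n : ℕ
  -- At least `B`, and greater than the length of `a ∷ p`, so that the power of `a` reaches `c`.
  n = suc (suc (length p + B))

decFrom-below : ∀ {a p c} r → All (_≤ a) p → c < a → decFrom a ((p ++ [ c ]) ++ r) ≡ true
decFrom-below r [] c<a = decFrom-> r c<a
decFrom-below {a} {b ∷ p} {c} r (b≤a ∷ bs) c<a with m≤n⇒m<n∨m≡n b≤a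
... | inj₁ b<a  = decFrom-> ((p ++ [ c ]) ++ r) b<a
... | inj₂ refl = trans (decFrom-≡ a ((p ++ [ c ]) ++ r)) (decFrom-below r bs c<a)

-- Letters below `a` miss the threshold, and those equal to `a` are decreases because `c` is still
-- to come. So only the head of a Lyndon factor can be a record.
records-below : ∀ {a p c} r → All (_≤ a) p → c < a → records a ((p ++ [ c ]) ++ r) ≡ records a r
records-below r [] c<a = records-small r (c<a ∷ [])
records-below {a} {b ∷ p} {c} r (b≤a ∷ bs) c<a with m≤n⇒m<n∨m≡n b≤a
... | inj₁ b<a  = trans (records-small ((p ++ [ c ]) ++ r) (b<a ∷ [])) (records-below r bs c<a)
... | inj₂ refl = trans (records-decrease a ((p ++ [ c ]) ++ r) (decFrom-below r bs c<a))
                    (trans (cong (λ n → records n ((p ++ [ c ]) ++ r)) (⊔-idem a)) (records-below r bs c<a))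

-- The next factor starts with a larger letter, or with `a` again. In the latter case `≼-long`
-- forces it to be the single letter `a`, so the plateau ends in an ascent or with the word.
single-not-decrease : ∀ {a ls} → All Lyndon ls → Linked _≼_ ([ a ] ∷ ls) → decFrom a (concat ls) ≡ false
single-not-decrease [] _ = refl
single-not-decrease {ls = [] ∷ _} (inj₁ () ∷ _) _
single-not-decrease {ls = [] ∷ _} (inj₂ (nonempty , _) ∷ _) _ = ⊥-elim (nonempty refl)
single-not-decrease {a} {(b ∷ t) ∷ ls} (ly ∷ lys) (a≼bt ∷ l) with m≤n⇒m<n∨m≡n (≼-head a≼bt)
... | inj₁ a<b = decFrom-< (t ++ concat ls) a<b
... | inj₂ refl with lyndon-shape a t ly
...   | single       = trans (decFrom-≡ a (concat ls)) (single-not-decrease lys l)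
...   | long p≤a c<a = ⊥-elim (≼-long p≤a c<a a≼bt)

mutual
  -- The heads of the factors weakly increase, so each meets the current threshold. It counts
  -- exactly when it is not a decrease, that is, when it is the whole factor: in a longer factor a
  -- smaller letter follows without a larger one in between.
  records-singles : ∀ {m a t ls} → m ≤ a → All Lyndon ((a ∷ t) ∷ ls) → Linked _≼_ ((a ∷ t) ∷ ls) →
    records m (concat ((a ∷ t) ∷ ls)) ≡ singles ((a ∷ t) ∷ ls)
  records-singles {m} {a} {t} {ls} m≤a lys@(ly ∷ lys′) l with lyndon-shape a t ly
  ... | single rewrite ≤ᵇ-true m≤a | single-not-decrease lys′ l | m≤n⇒m⊔n≡n m≤a =
          cong suc (records-singles-next lys l)
  ... | long {p} {c} p≤a c<a = begin
          records m (a ∷ (p ++ [ c ]) ++ concat ls)      ≡⟨ records-decrease m ((p ++ [ c ]) ++ concat ls) (decFrom-below (concat ls) p≤a c<a) ⟩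
          records (m ⊔ a) ((p ++ [ c ]) ++ concat ls)    ≡⟨ cong (λ n → records n ((p ++ [ c ]) ++ concat ls)) (m≤n⇒m⊔n≡n m≤a) ⟩
          records a ((p ++ [ c ]) ++ concat ls)          ≡⟨ records-below (concat ls) p≤a c<a ⟩
          records a (concat ls)                          ≡⟨ records-singles-next lys l ⟩
          singles ls                                     ≡⟨ singles-long p ⟨
          singles ((a ∷ p ++ [ c ]) ∷ ls)                ∎
    where
    open ≡-Reasoning
    singles-long : ∀ p {c} → singles ((a ∷ p ++ [ c ]) ∷ ls) ≡ singles ls
    singles-long []      = refl
    singles-long (_ ∷ _) = refl

  records-singles-next : ∀ {a t ls} → All Lyndon ((a ∷ t) ∷ ls) → Linked _≼_ ((a ∷ t) ∷ ls) →
    records a (concat ls) ≡ singles ls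
  records-singles-next {ls = []} _ _ = refl
  records-singles-next {ls = [] ∷ _} (_ ∷ inj₁ () ∷ _) _
  records-singles-next {ls = [] ∷ _} (_ ∷ inj₂ (nonempty , _) ∷ _) _ = ⊥-elim (nonempty refl)
  records-singles-next {ls = (b ∷ s) ∷ ls} (_ ∷ lys) (at≼bs ∷ l) = records-singles (≼-head at≼bs) lys l

records≡singles : ∀ {w ls} → LyndonFactorization w ls → records 0 w ≡ singles ls
records≡singles {ls = []} (refl , _ , _) = refl
records≡singles {ls = [] ∷ _} (_ , inj₁ () ∷ _ , _)
records≡singles {ls = [] ∷ _} (_ , inj₂ (nonempty , _) ∷ _ , _) = ⊥-elim (nonempty refl)
records≡singles {ls = (a ∷ t) ∷ ls} (refl , lys , l) = records-singles z≤n lys l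

theorem6p1 : ∃ λ (F : Word → Word) →
    ((∀ w → F w ↭ w)
    × (∀ v w → F v ≡ F w → v ≡ w)
    × (∀ w → ∃ λ v → v ↭ w × F v ≡ w))
    × (∀ w (ls : List Word) → LyndonFactorization w ls →
    ∀ (u : Word) (hs : List Word) → HFactorization (F w) u hs →
    (dec w ≡ wlecOf hs) × (singles ls ≡ length u))
theorem6p1 = transform , (transform-↭ , transform-injective , surjective) , statistics
  where
  surjective : ∀ w → ∃ λ v → v ↭ w × transform v ≡ w
  surjective w with transform-surjective w
  ... | v , refl = v , ↭-sym (transform-↭ v) , refl

  statistics : ∀ w (ls : List Word) → LyndonFactorization w ls →
    ∀ (u : Word) (hs : List Word) → HFactorization (transform w) u hs →
    (dec w ≡ wlecOf hs) × (singles ls ≡ length u)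
  statistics w ls f u hs g =
      subst (λ v → dec v ≡ wlecOf hs) (reverse-involutive w) (build-dec b)
    , trans (sym (records≡singles f))
        (subst (λ v → records 0 v ≡ length u) (reverse-involutive w) (build-records b))
    where
    b : Build (reverse w) u hs
    b = transform-HFactorization w g
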